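{- $r'_2(6)=18$.
   Context: All graphs are finite and simple. A threshold graph of order $s$ is an $s$-vertex graph that can be constructed from the one-vertex graph by repeatedly adding a new vertex that is either adjacent to all the previous vertices or nonadjacent to all the previous vertices. For a positive integer $s$, $r'_2(s)$ is the minimum integer $n$ such that every $n$-vertex graph contains a threshold graph of order $s$ as an induced subgraph. -}

module Defs where

open import Data.Bool.Base using (Bool; false)
open import Data.Fin.Base using (Fin; zero; suc)
open import Data.Nat.Base using (ℕ; suc; _≤_)
open import Data.Product.Base using (_×_; ∃-syntax)
open import Function.Bundles using (_↔_; _↣_; Inverse; Injection)
open import Relation.Binary.PropositionalEquality.Core using (_≡_; refl)
open import Relation.Unary using (Pred)

-- Finite simple graphs on the vertex set Fin n.  Adjacency is Bool-valued,
-- which is no restriction classically and gives the usual finite objects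
-- constructively.
record Graph (n : ℕ) : Set where
  field
    adj    : Fin n → Fin n → Bool
    sym    : ∀ u v → adj u v ≡ adj v u
    irrefl : ∀ v → adj v v ≡ false

open Graph public using (adj)

infix 4 _≅_ _⊑_

record _≅_ {m n} (G : Graph m) (H : Graph n) : Set where
  field
    vertices : Fin m ↔ Fin n
    adj-cong : ∀ u v →
      adj H (Inverse.to vertices u) (Inverse.to vertices v) ≡ adj G u v

-- H ⊑ G: some induced subgraph of G is isomorphic to H.  Both adjacency and
-- nonadjacency are preserved, so the image of the injection induces a copy of H.
record _⊑_ {m n} (H : Graph m) (G : Graph n) : Set where
  field
    vertices : Fin m ↣ Fin n
    adj-cong : ∀ u v →
      adj G (Injection.to vertices u) (Injection.to vertices v) ≡ adj H u v

K₁ : Graph 1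
K₁ = record
  { adj    = λ _ _ → false
  ; sym    = λ _ _ → refl
  ; irrefl = λ _ → refl
  }

-- The new vertex is zero; it is adjacent to every old vertex if b is true and
-- to none if b is false.
addVertex : ∀ {n} → Bool → Graph n → Graph (suc n)
addVertex {n} b G = record { adj = adj′ ; sym = sym′ ; irrefl = irrefl′ }
  where
  adj′ : Fin (suc n) → Fin (suc n) → Bool
  adj′ zero    zero    = false
  adj′ zero    (suc _) = b
  adj′ (suc _) zero    = b
  adj′ (suc u) (suc v) = adj G u v

  sym′ : ∀ u v → adj′ u v ≡ adj′ v u
  sym′ zero    zero    = refl
  sym′ zero    (suc _) = refl
  sym′ (suc _) zero    = refl
  sym′ (suc u) (suc v) = Graph.sym G u v

  irrefl′ : ∀ v → adj′ v v ≡ false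
  irrefl′ zero    = refl
  irrefl′ (suc v) = Graph.irrefl G v

data Constructible : ∀ {s} → Graph s → Set where
  one-vertex : Constructible K₁
  add-vertex : ∀ {s} {G : Graph s} (b : Bool) →
               Constructible G → Constructible (addVertex b G)

-- The construction labels the vertices in a fixed order, so being threshold is
-- its closure under isomorphism.
Threshold : ∀ {s} → Graph s → Set
Threshold {s} G = ∃[ H ] Constructible {s} H × H ≅ G

ForcesThreshold : ℕ → Pred ℕ _
ForcesThreshold s n = (G : Graph n) → ∃[ H ] Threshold {s} H × H ⊑ G

IsMinimumOf : ∀ {ℓ} → Pred ℕ ℓ → Pred ℕ ℓ
IsMinimumOf P n = P n × (∀ m → P m → n ≤ m)

-- Existence of the minimum is a Ramsey-type theorem, so r′₂ is given as a
-- relation: r′₂[ s ]≡ n says that the minimum exists and equals n.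
r′₂[_]≡_ : ℕ → Pred ℕ _
r′₂[ s ]≡ n = IsMinimumOf (ForcesThreshold s) n

{-# OPTIONS --safe #-}
-- A vertex joined in the same way to all vertices of a threshold graph extends
-- it.  Write Tₖ for a threshold graph of order k.  A 5-vertex graph without T₄ is
-- a 5-cycle, and an exhaustive search shows that a 5-cycle together with any 4
-- further vertices contains T₅.  So in a graph without T₅ on at least 9 vertices
-- every set of 5 vertices contains T₄; hence every vertex has at most 4 neighbours
-- and at most 4 non-neighbours, and there are exactly 9 vertices.
--
-- In a graph without T₆ on 18 vertices, some vertex x has, up to complementation,
-- a set H of 9 neighbours and a set W of 8 non-neighbours.  A vertex of W has at
-- most 4 non-neighbours in H: otherwise T₄ among these, x and the vertex itself
-- form T₆.  So there are at least 8 · 5 edges between W and H.  But a vertex of H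
-- has at most 9 neighbours, among them x and 4 vertices of H, which leaves at most
-- 9 · 4 edges.
--
-- The Paley graph on 17 vertices has no T₆.
module Submission where

open import Data.Bool.Base using (Bool; true; false; not; T)
open import Data.Bool.ListAction using (all)
import Data.Bool.Properties as Bool
open import Data.Empty using (⊥)
open import Data.Fin.Base using (Fin; zero; suc; toℕ; inject≤)
import Data.Fin.Properties as Fin
open import Data.List.Base
  using (List; []; _∷_; _++_; length; map; filter; concatMap; allFin; tabulate)
import Data.List.Properties as List
open import Data.List.Membership.Propositional using (_∈_; _∉_; find; lose)
open import Data.List.Membership.Propositional.Properties
  using (∈-filter⁺; ∈-filter⁻; ∈-allFin; ∈-tabulate⁺; ∈-++⁻; ∈-concatMap⁺)
open import Data.List.Relation.Binary.Subset.Propositional using (_⊆_)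
open import Data.List.Relation.Unary.All as All using (All; []; _∷_)
open import Data.List.Relation.Unary.Any as Any using (Any; here; there)
import Data.List.Relation.Unary.All.Properties as All
open import Data.List.Relation.Unary.AllPairs using ([]; _∷_)
open import Data.List.Relation.Unary.Unique.Propositional using (Unique)
import Data.List.Relation.Unary.Unique.Propositional.Properties as Unique
open import Data.Nat.Base using (ℕ; zero; suc; _+_; _*_; _≤_; z≤n; s≤s; s≤s⁻¹; ∣_-_∣)
open import Data.Nat.ListAction using (sum)
import Data.Nat.Properties as ℕ
open import Algebra.Properties.CommutativeSemigroup ℕ.+-commutativeSemigroup
  using (x∙yz≈y∙xz)
open import Data.List.Membership.DecPropositional ℕ._≟_ using (_∈?_)
open import Data.Product.Base using (_×_; _,_; proj₁; proj₂; ∃; ∃-syntax)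
open import Data.Sum.Base using (_⊎_; inj₁; inj₂; [_,_])
open import Data.Unit.Base using (⊤; tt)
open import Data.Vec.Base as Vec using (Vec; []; _∷_; lookup)
import Data.Vec.Properties as Vec
open import Function.Base using (_∘_; id; flip)
open import Function.Bundles using (Equivalence; Injection; mk↣)
open import Function.Construct.Identity using (↔-id)
open import Function.Properties.Inverse using (↔⇒↣)
open import Relation.Binary.PropositionalEquality
  using (_≡_; _≢_; refl; sym; trans; cong; cong₂; subst)
open import Relation.Nullary using (¬_; Dec; yes; no; does; ¬?; contradiction)
open import Relation.Nullary.Decidable
  using (map′; _⊎-dec_; _×-dec_; _→-dec_; isYes; toWitness; toWitnessFalse; decidable-stable)

open import Defs

-- Neighbourhoods and threshold subgraphs in lists of vertices

Adj : ℕ → Set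
Adj n = Fin n → Fin n → Bool

module _ {A : Set} (f : A → Bool) where

  -- Edges and non-edges are the two colours of a pair, so that one argument serves a graph and its
  -- complement.
  ofColour : Bool → List A → List A
  ofColour c = filter (λ u → f u Bool.≟ c)

  length-ofColour : ∀ c xs → length (ofColour c xs) + length (ofColour (not c) xs) ≡ length xs
  length-ofColour c     []       = refl
  length-ofColour c     (x ∷ xs) with f x
  length-ofColour true  (x ∷ xs) | true  = cong suc (length-ofColour true xs)
  length-ofColour true  (x ∷ xs) | false = trans (ℕ.+-suc _ _) (cong suc (length-ofColour true xs))
  length-ofColour false (x ∷ xs) | true  = trans (ℕ.+-suc _ _) (cong suc (length-ofColour false xs))
  length-ofColour false (x ∷ xs) | false = cong suc (length-ofColour false xs)

∈-ofColour⁻ : ∀ {A : Set} (f : A → Bool) {c u} xs → u ∈ ofColour f c xs → u ∈ xs × f u ≡ c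
∈-ofColour⁻ f {c} xs = ∈-filter⁻ (λ u → f u Bool.≟ c) {xs = xs}

module _ {n : ℕ} where

  infixl 6 _-_ _∖_

  _≢?_ : (u x : Fin n) → Dec (u ≢ x)
  u ≢? x = ¬? (u Fin.≟ x)

  _-_ : List (Fin n) → Fin n → List (Fin n)
  xs - x = filter (_≢? x) xs

  _∖_ : List (Fin n) → List (Fin n) → List (Fin n)
  xs ∖ []       = xs
  xs ∖ (u ∷ us) = (xs - u) ∖ us

  length-minus : ∀ x {xs} → Unique xs → length xs ≤ suc (length (xs - x))
  length-minus x []                     = z≤n
  length-minus x {y ∷ ys} (y∉ys ∷ uniq) with y Fin.≟ x
  ... | no  _    = s≤s (length-minus x uniq)
  ... | yes refl = s≤s (ℕ.≤-reflexive (sym (cong length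
                     (List.filter-all (_≢? x) (All.map (_∘ sym) y∉ys)))))

  length-∖ : ∀ us {xs} → Unique xs → length xs ≤ length us + length (xs ∖ us)
  length-∖ []       uniq = ℕ.≤-refl
  length-∖ (u ∷ us) uniq = ℕ.≤-trans (length-minus u uniq) (s≤s (length-∖ us (Unique.filter⁺ _ uniq)))

  Unique-∖ : ∀ us {xs} → Unique xs → Unique (xs ∖ us)
  Unique-∖ []       uniq = uniq
  Unique-∖ (u ∷ us) uniq = Unique-∖ us (Unique.filter⁺ _ uniq)

  ∈-∖⁻ : ∀ us {xs w} → w ∈ xs ∖ us → w ∈ xs × w ∉ us
  ∈-∖⁻ []       w∈ = w∈ , λ ()
  ∈-∖⁻ (u ∷ us) {xs} w∈ with ∈-∖⁻ us w∈
  ... | w∈xs-u , w∉us with ∈-filter⁻ (_≢? u) {xs = xs} w∈xs-u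
  ...   | w∈xs , w≢u = w∈xs , λ { (here w≡u) → w≢u w≡u ; (there w∈us) → w∉us w∈us }

  module _ (a : Adj n) where

    -- In a graph `a x x` is `false`, so `x` is removed first, lest it count among its own
    -- non-neighbours.
    N : Bool → Fin n → List (Fin n) → List (Fin n)
    N c x xs = ofColour (a x) c (xs - x)

    ∈-N⁺ : ∀ {c u} x xs → u ∈ xs → u ≢ x → a x u ≡ c → u ∈ N c x xs
    ∈-N⁺ x xs u∈ u≢x axu≡c = ∈-filter⁺ _ (∈-filter⁺ _ u∈ u≢x) axu≡c

    ∈-N⁻ : ∀ {c x u} xs → u ∈ N c x xs → u ∈ xs × u ≢ x × a x u ≡ c
    ∈-N⁻ {x = x} xs u∈ with ∈-ofColour⁻ (a x) (xs - x) u∈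
    ... | u∈xs-x , axu≡c with ∈-filter⁻ (_≢? x) {xs = xs} u∈xs-x
    ...   | u∈xs , u≢x = u∈xs , u≢x , axu≡c

    Unique-N : ∀ {c x xs} → Unique xs → Unique (N c x xs)
    Unique-N uniq = Unique.filter⁺ _ (Unique.filter⁺ _ uniq)

    length-N : ∀ c x {xs} → Unique xs → length xs ≤ suc (length (N c x xs) + length (N (not c) x xs))
    length-N c x {xs} uniq = ℕ.≤-trans (length-minus x uniq)
      (s≤s (ℕ.≤-reflexive (sym (length-ofColour (a x) c (xs - x)))))

    -- Some k vertices of xs induce a threshold graph; x is the last one added.
    Has : ℕ → List (Fin n) → Set
    Has zero    xs = ⊤
    Has (suc k) xs = Any (λ x → ∃[ c ] Has k (N c x xs)) xs

    has-length : ∀ k {xs} → Has k xs → k ≤ length xs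
    has-length zero    h = z≤n
    has-length (suc k) {xs} h with find h
    ... | x , x∈xs , c , h′ = ℕ.<-≤-trans
      (s≤s (ℕ.≤-trans (has-length k h′) (List.length-filter _ (xs - x))))
      (List.filter-notAll (_≢? x) xs (Any.map (λ x≡u u≢x → u≢x (sym x≡u)) x∈xs))

    -- The length test only prunes, but without it the searches are too slow.
    has? : ∀ k xs → Dec (Has k xs)
    has? zero    xs = yes tt
    has? (suc k) xs with suc k ℕ.≤? length xs
    ... | no  k≰ = no (k≰ ∘ has-length (suc k))
    ... | yes _  = Any.any? (λ x → map′ [ true ,_ , false ,_ ]
                     (λ { (true , h) → inj₁ h ; (false , h) → inj₂ h })
                     (has? k (N true x xs) ⊎-dec has? k (N false x xs))) xs

-- Embeddings

IsEmbedding : ∀ {m n} → Adj m → Adj n → (Fin m → Fin n) → Set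
IsEmbedding a b f = (∀ i j → b (f i) (f j) ≡ a i j) × (∀ i j → f i ≡ f j → i ≡ j)

isEmbedding? : ∀ {m n} (a : Adj m) (b : Adj n) f → Dec (IsEmbedding a b f)
isEmbedding? a b f =
  Fin.all? (λ i → Fin.all? λ j → b (f i) (f j) Bool.≟ a i j) ×-dec
  Fin.all? (λ i → Fin.all? λ j → (f i Fin.≟ f j) →-dec (i Fin.≟ j))

module _ {m n} {a : Adj m} {b : Adj n} {f : Fin m → Fin n} (emb : IsEmbedding a b f) where

  -- Injectivity keeps `f i` apart from `f x`, so neighbourhoods map into neighbourhoods of the same
  -- colour.
  has-map : ∀ k {is xs} → (∀ {i} → i ∈ is → f i ∈ xs) → Has a k is → Has b k xs
  has-map zero    sub h = tt
  has-map (suc k) {is} {xs} sub h with find h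
  ... | x , x∈is , c , h′ = lose (sub x∈is) (c , has-map k sub′ h′)
    where
    sub′ : ∀ {i} → i ∈ N a c x is → f i ∈ N b c (f x) xs
    sub′ i∈ with ∈-N⁻ a is i∈
    ... | i∈is , i≢x , axi≡c =
      ∈-N⁺ b (f x) xs (sub i∈is) (i≢x ∘ proj₂ emb _ _) (trans (proj₁ emb _ _) axi≡c)

∘-embedding : ∀ {l m n} {a : Adj l} {b : Adj m} {c : Adj n} {f g} →
              IsEmbedding a b f → IsEmbedding b c g → IsEmbedding a c (g ∘ f)
∘-embedding (f-cong , f-inj) (g-cong , g-inj) =
  (λ i j → trans (g-cong _ _) (f-cong i j)) , (λ i j → f-inj i j ∘ g-inj _ _)

module _ {n} (a : Adj n) where

  has-mono : ∀ k {xs ys} → xs ⊆ ys → Has a k xs → Has a k ys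
  has-mono k = has-map ((λ _ _ → refl) , (λ _ _ → id)) k

  has-add : ∀ k {c x xs ys} → x ∈ xs → ys ⊆ N a c x xs → Has a k ys → Has a (suc k) xs
  has-add k x∈xs sub h = lose x∈xs (_ , has-mono k sub h)

-- Threshold graphs

constructible⇒has : ∀ {s} {H : Graph s} → Constructible H → Has (adj H) s (allFin s)
-- The first vertex has nothing to be joined to, so either colour serves.
constructible⇒has one-vertex       = here (true , tt)
constructible⇒has (add-vertex {G = G} b C) = lose (∈-allFin zero) (b , has-map
  ((λ _ _ → refl) , (λ _ _ → Fin.suc-injective)) _
  (λ _ → ∈-N⁺ (adj (addVertex b G)) zero (allFin _) (∈-allFin _) (λ ()) refl) (constructible⇒has C))

threshold⇒has : ∀ {s} {H : Graph s} → Threshold H → Has (adj H) s (allFin s)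
threshold⇒has (H₀ , C , iso) = has-map
  (_≅_.adj-cong iso , λ _ _ → Injection.injective (↔⇒↣ (_≅_.vertices iso))) _
  (λ _ → ∈-allFin _) (constructible⇒has C)

module _ {n} (G : Graph n) where

  -- The construction starts from one vertex and `Has` from none, hence `suc k`. Tracking `f i ∈ xs`
  -- keeps the smaller copy inside `N c x xs`, which determines how `x` is joined to it.
  has⇒constructible : ∀ k {xs} → Has (adj G) (suc k) xs →
    ∃[ H ] Constructible {suc k} H × ∃[ f ] IsEmbedding (adj H) (adj G) f × (∀ i → f i ∈ xs)
  has⇒constructible zero h with find h
  ... | x , x∈xs , _ = K₁ , one-vertex , (λ _ → x) ,
    ((λ _ _ → Graph.irrefl G x) , λ { zero zero _ → refl }) , λ _ → x∈xs
  has⇒constructible (suc k) {xs} h with find h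
  ... | x , x∈xs , c , h′ with has⇒constructible k h′
  ...   | H , C , f , (f-cong , f-inj) , f∈ =
    addVertex c H , add-vertex c C , f⁺ , (f⁺-cong , f⁺-inj) , f⁺∈
    where
    f⁺ : Fin (suc (suc k)) → Fin n
    f⁺ zero    = x
    f⁺ (suc i) = f i

    f∈N : ∀ i → f i ∈ xs × f i ≢ x × adj G x (f i) ≡ c
    f∈N i = ∈-N⁻ (adj G) xs (f∈ i)

    f⁺-cong : ∀ i j → adj G (f⁺ i) (f⁺ j) ≡ adj (addVertex c H) i j
    f⁺-cong zero    zero    = Graph.irrefl G x
    f⁺-cong zero    (suc j) = proj₂ (proj₂ (f∈N j))
    f⁺-cong (suc i) zero    = trans (Graph.sym G _ _) (proj₂ (proj₂ (f∈N i)))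
    f⁺-cong (suc i) (suc j) = f-cong i j

    f⁺-inj : ∀ i j → f⁺ i ≡ f⁺ j → i ≡ j
    f⁺-inj zero    zero    _  = refl
    f⁺-inj zero    (suc j) eq = contradiction (sym eq) (proj₁ (proj₂ (f∈N j)))
    f⁺-inj (suc i) zero    eq = contradiction eq (proj₁ (proj₂ (f∈N i)))
    f⁺-inj (suc i) (suc j) eq = cong suc (f-inj i j eq)

    f⁺∈ : ∀ i → f⁺ i ∈ xs
    f⁺∈ zero    = x∈xs
    f⁺∈ (suc i) = proj₁ (f∈N i)

  has⇒threshold : ∀ k {xs} → Has (adj G) (suc k) xs → ∃[ H ] Threshold {suc k} H × H ⊑ G
  has⇒threshold k h with has⇒constructible k h
  ... | H , C , f , (f-cong , f-inj) , _ =
    H , (H , C , record { vertices = ↔-id _ ; adj-cong = λ _ _ → refl }) ,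
    record { vertices = mk↣ (f-inj _ _) ; adj-cong = f-cong }

-- Exhaustive search

extend : ∀ {n} → Adj n → Vec Bool n → Adj (suc n)
extend e r zero    zero    = false
extend e r zero    (suc j) = lookup r j
extend e r (suc i) zero    = lookup r i
extend e r (suc i) (suc j) = e i j

prepend : ∀ {n} → List (Vec Bool n) → List (Vec Bool (suc n))
prepend = concatMap λ r → (true ∷ r) ∷ (false ∷ r) ∷ []

∈-prepend : ∀ {n} b {r : Vec Bool n} {rs} → r ∈ rs → b ∷ r ∈ prepend rs
∈-prepend b r∈ = ∈-concatMap⁺ _ (Any.map (λ { refl → ∈pair b }) r∈)
  where
  ∈pair : ∀ b {n} {r : Vec Bool n} → b ∷ r ∈ (true ∷ r) ∷ (false ∷ r) ∷ []
  ∈pair true  = here refl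
  ∈pair false = there (here refl)

rows : ∀ n → List (Vec Bool n)
rows zero    = [] ∷ []
rows (suc n) = prepend (rows n)

∈-rows : ∀ {n} (r : Vec Bool n) → r ∈ rows n
∈-rows []      = here refl
∈-rows (b ∷ r) = ∈-prepend b (∈-rows r)

-- Each candidate is tested alone against `e`. A conflict between two candidates shows once one of
-- them has joined `e` and the row of the other has gained an entry.
compatible : ∀ {n} → ℕ → Adj n → List (Vec Bool n) → List (Vec Bool n)
compatible t e = filter (λ r → ¬? (has? (extend e r) t (allFin _)))

-- Opaque, since otherwise conversion checking reruns the searches.
opaque

  -- p holds for every extension of e by m vertices which has no threshold graph
  -- of order t, provided that the rows towards e of the m vertices belong to rs.
  search : ℕ → ℕ → (∀ {n} → Adj n → Bool) → ∀ {n} → Adj n → List (Vec Bool n) → Bool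
  search t zero    p e rs = p e
  search t (suc m) p e rs =
    all (λ r → search t m p (extend e r) (compatible t (extend e r) (prepend rs))) rs

module _ {n} (G : Graph n) where

  private a = adj G

  rowTo : ∀ {l} → (Fin l → Fin n) → Fin n → Vec Bool l
  rowTo f w = Vec.tabulate (a w ∘ f)

  _◂_ : ∀ {l} → Fin n → (Fin l → Fin n) → Fin (suc l) → Fin n
  (w ◂ f) zero    = w
  (w ◂ f) (suc i) = f i

  extend-embedding : ∀ {l} {e : Adj l} {f w} → IsEmbedding e a f → (∀ i → f i ≢ w) →
                     IsEmbedding (extend e (rowTo f w)) a (w ◂ f)
  extend-embedding {l} {e} {f} {w} (f-cong , f-inj) w∉f = cong′ , inj′
    where
    row : ∀ i → a w (f i) ≡ lookup (rowTo f w) i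
    row i = sym (Vec.lookup∘tabulate (a w ∘ f) i)

    cong′ : ∀ i j → a ((w ◂ f) i) ((w ◂ f) j) ≡ extend e (rowTo f w) i j
    cong′ zero    zero    = Graph.irrefl G w
    cong′ zero    (suc j) = row j
    cong′ (suc i) zero    = trans (Graph.sym G _ _) (row i)
    cong′ (suc i) (suc j) = f-cong i j

    inj′ : ∀ i j → (w ◂ f) i ≡ (w ◂ f) j → i ≡ j
    inj′ zero    zero    _  = refl
    inj′ zero    (suc j) eq = contradiction (sym eq) (w∉f j)
    inj′ (suc i) zero    eq = contradiction eq (w∉f i)
    inj′ (suc i) (suc j) eq = cong suc (f-inj i j eq)

  opaque
    unfolding search

    -- Follows the branch given by the actual rows of the vertices in `ws`. No row of a vertex still
    -- waiting is discarded, since the threshold graph causing that would map into `xs`. Working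
    -- relative to `xs` lets the search run inside neighbourhoods.
    search-sound : ∀ t m (p : ∀ {l} → Adj l → Bool) {l} {e : Adj l} {rs f xs} ws →
      T (search t m p e rs) → ¬ Has a t xs →
      IsEmbedding e a f → (∀ i → f i ∈ xs) →
      Unique ws → m ≤ length ws → ws ⊆ xs →
      (∀ {w} → w ∈ ws → ∀ i → f i ≢ w) → (∀ {w} → w ∈ ws → rowTo f w ∈ rs) →
      ∃[ l′ ] ∃[ e′ ] T (p {l′} e′) × ∃[ g ] IsEmbedding e′ a g × (∀ i → g i ∈ xs)
    search-sound t zero    p ws s free emb f∈ _ _ _ _ _ = _ , _ , s , _ , emb , f∈
    search-sound t (suc m) p {e = e} {rs} {f} {xs} (w ∷ ws) s free emb f∈ (w∉ws ∷ uniq) (s≤s m≤) ws⊆ f∌ws row∈ =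
      search-sound t m p ws (All.lookup (All.all⁺ _ rs s) (row∈ (here refl))) free emb′ ◂∈ uniq m≤ (ws⊆ ∘ there) ◂∌ws row′∈
      where
      emb′ : IsEmbedding (extend e (rowTo f w)) a (w ◂ f)
      emb′ = extend-embedding emb (f∌ws (here refl))

      ◂∈ : ∀ i → (w ◂ f) i ∈ xs
      ◂∈ zero    = ws⊆ (here refl)
      ◂∈ (suc i) = f∈ i

      ◂∌ws : ∀ {v} → v ∈ ws → ∀ i → (w ◂ f) i ≢ v
      ◂∌ws v∈ zero    = All.lookup w∉ws v∈
      ◂∌ws v∈ (suc i) = f∌ws (there v∈) i

      row′∈ : ∀ {v} → v ∈ ws → rowTo (w ◂ f) v ∈ compatible t (extend e (rowTo f w)) (prepend rs)
      row′∈ {v} v∈ = ∈-filter⁺ _ (∈-prepend _ (row∈ (there v∈)))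
        λ h → free (has-map (extend-embedding emb′ (◂∌ws v∈)) t (λ {i} _ → ◂◂∈ i) h)
        where
        ◂◂∈ : ∀ i → (v ◂ (w ◂ f)) i ∈ xs
        ◂◂∈ zero    = ws⊆ (there v∈)
        ◂◂∈ (suc i) = ◂∈ i

-- Maps out of `Fin m` are represented by vectors, which allows a search entry by entry.
∃vec? : ∀ {n} m {P : Vec (Fin n) m → Set} → (∀ v → Dec (P v)) → Dec (∃ P)
∃vec? zero    P? = map′ ([] ,_) (λ { ([] , p) → p }) (P? [])
∃vec? (suc m) P? = map′ (λ (x , v , p) → x ∷ v , p) (λ { (x ∷ v , p) → x , v , p })
  (Fin.any? λ x → ∃vec? m (λ v → P? (x ∷ v)))

-- A row refers to the latest of the earlier vertices first.
C₅ : Adj 5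
C₅ = extend (extend (extend (extend (extend (λ ())
       [])
       (true ∷ []))
       (true ∷ false ∷ []))
       (true ∷ false ∷ false ∷ []))
       (true ∷ false ∷ false ∷ true ∷ [])

opaque

  containsC₅? : ∀ {n} (e : Adj n) → Dec (∃[ v ] IsEmbedding C₅ e (lookup v))
  containsC₅? e = ∃vec? 5 λ v → isEmbedding? C₅ e (lookup v)

opaque
  unfolding search containsC₅?

  search-C₅ : search 4 5 (λ e → isYes (containsC₅? e)) (λ ()) ([] ∷ []) ≡ true
  search-C₅ = refl

  -- As `p` is constantly `false`, success means that every branch runs out of rows before a fourth
  -- vertex is added.
  search-extensions-of-C₅ : search 5 4 (λ _ → false) C₅ (rows 5) ≡ true
  search-extensions-of-C₅ = refl

-- Double counting

module _ {A B : Set} (r : A → B → Bool) (c : Bool) where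

  degrees : List A → List B → List ℕ
  degrees xs ys = map (λ x → length (ofColour (r x) c ys)) xs

-- Adjoining `x` raises the degree of exactly those `y` with `r y x ≡ c`, and the first summand
-- counts them.
sum-degrees-∷ : ∀ {A B : Set} (r : B → A → Bool) c x xs ys →
  length (ofColour (flip r x) c ys) + sum (degrees r c ys xs) ≡ sum (degrees r c ys (x ∷ xs))
sum-degrees-∷ r c x xs []       = refl
sum-degrees-∷ r c x xs (y ∷ ys) with sum-degrees-∷ r c x xs ys | does (r y x Bool.≟ c)
... | ih | true  = cong suc (trans (x∙yz≈y∙xz (length (ofColour (flip r x) c ys))
                     (length (ofColour (r y) c xs)) (sum (degrees r c ys xs)))
                     (cong (length (ofColour (r y) c xs) +_) ih))
... | ih | false = trans (x∙yz≈y∙xz (length (ofColour (flip r x) c ys))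
                     (length (ofColour (r y) c xs)) (sum (degrees r c ys xs)))
                     (cong (length (ofColour (r y) c xs) +_) ih)

sum-degrees-[] : ∀ {A B : Set} (r : B → A → Bool) c ys → sum (degrees r c ys []) ≡ 0
sum-degrees-[] r c []       = refl
sum-degrees-[] r c (y ∷ ys) = sum-degrees-[] r c ys

-- Both sides count the pairs of colour `c` between `xs` and `ys`.
sum-degrees-comm : ∀ {A B : Set} (r : A → B → Bool) c xs ys →
  sum (degrees r c xs ys) ≡ sum (degrees (flip r) c ys xs)
sum-degrees-comm r c []       ys = sym (sum-degrees-[] (flip r) c ys)
sum-degrees-comm r c (x ∷ xs) ys = trans
  (cong (length (ofColour (r x) c ys) +_) (sum-degrees-comm r c xs ys))
  (sum-degrees-∷ (flip r) c x xs ys)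

module _ {A : Set} (f : A → ℕ) where

  sum-map-≥ : ∀ k xs → (∀ {x} → x ∈ xs → k ≤ f x) → length xs * k ≤ sum (map f xs)
  sum-map-≥ k []       k≤ = z≤n
  sum-map-≥ k (x ∷ xs) k≤ = ℕ.+-mono-≤ (k≤ (here refl)) (sum-map-≥ k xs (k≤ ∘ there))

  sum-map-≤ : ∀ k xs → (∀ {x} → x ∈ xs → f x ≤ k) → sum (map f xs) ≤ length xs * k
  sum-map-≤ k []       ≤k = z≤n
  sum-map-≤ k (x ∷ xs) ≤k = ℕ.+-mono-≤ (≤k (here refl)) (sum-map-≤ k xs (≤k ∘ there))

-- The upper bound

module _ {n} (G : Graph n) where

  private a = adj G

  find-C₅ : ∀ {xs} → Unique xs → 5 ≤ length xs → ¬ Has a 4 xs →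
    ∃[ f ] IsEmbedding C₅ a f × (∀ i → f i ∈ xs)
  find-C₅ {xs} xs! 5≤xs no4
    with search-sound G 4 5 (λ e → isYes (containsC₅? e)) {f = λ ()} xs
           (Equivalence.from Bool.T-≡ search-C₅) no4 ((λ ()) , λ ()) (λ ()) xs! 5≤xs id (λ _ ())
           -- Towards the empty graph the only row is the empty one.
           (λ _ → here refl)
  ... | _ , e , found , g , g-emb , g∈xs with toWitness {a? = containsC₅? e} found
  ...   | v , v-emb = g ∘ lookup v , ∘-embedding {b = e} {c = a} v-emb g-emb , g∈xs ∘ lookup v

  no-C₅ : ∀ {xs f} → Unique xs → 9 ≤ length xs → ¬ Has a 5 xs →
    IsEmbedding C₅ a f → ¬ (∀ i → f i ∈ xs)
  -- The search draws on the vertices off the cycle, at least 9 - 5 = 4 of them, and a completed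
  -- branch yields `T false`.
  no-C₅ {xs} {f} xs! 9≤xs no5 emb f∈xs = proj₁ (proj₂ (proj₂ (
    search-sound G 5 4 (λ _ → false) {f = f} (xs ∖ us)
      (Equivalence.from Bool.T-≡ search-extensions-of-C₅) no5 emb f∈xs
      (Unique-∖ us xs!)
      (ℕ.+-cancelˡ-≤ 5 4 _ (ℕ.≤-trans 9≤xs (length-∖ us xs!)))
      (λ w∈ → proj₁ (∈-∖⁻ us {xs} w∈))
      (λ w∈ i fi≡w → proj₂ (∈-∖⁻ us {xs} w∈) (subst (_∈ us) fi≡w (∈-tabulate⁺ {f = f} i)))
      (λ _ → ∈-rows _))))
    where
    us = tabulate f

  length-without-T₄ : ∀ {xs ys} → Unique xs → 9 ≤ length xs → ¬ Has a 5 xs →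
    Unique ys → ys ⊆ xs → ¬ Has a 4 ys → length ys ≤ 4
  length-without-T₄ xs! 9≤xs no5 ys! ys⊆xs no4 = ℕ.≮⇒≥ λ 5≤ys →
    let f , emb , f∈ys = find-C₅ ys! 5≤ys no4
    in no-C₅ xs! 9≤xs no5 emb (ys⊆xs ∘ f∈ys)

  free-N : ∀ {k c x xs} → x ∈ xs → ¬ Has a (suc k) xs → ¬ Has a k (N a c x xs)
  free-N x∈xs free h = free (lose x∈xs (_ , h))

  length-N-without-T₅ : ∀ {c x xs} → Unique xs → 9 ≤ length xs → ¬ Has a 5 xs →
    x ∈ xs → length (N a c x xs) ≤ 4
  length-N-without-T₅ {xs = xs} xs! 9≤xs no5 x∈xs = length-without-T₄ xs! 9≤xs no5
    (Unique-N a xs!) (proj₁ ∘ ∈-N⁻ a xs) (free-N x∈xs no5)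

  -- The degree bound asks for nine vertices, so it is applied to a list supposed longer than nine,
  -- where `x` and its two neighbourhoods account for only 1 + 4 + 4.
  length-without-T₅ : ∀ {xs} → Unique xs → ¬ Has a 5 xs → length xs ≤ 9
  length-without-T₅ {[]}           xs! no5 = z≤n
  length-without-T₅ {xs@(x ∷ _)} xs! no5 = ℕ.≮⇒≥ λ 9<xs → ℕ.n≮n 9
    (ℕ.≤-trans 9<xs (ℕ.≤-trans (length-N a true x xs!)
      (s≤s (ℕ.+-mono-≤ (few (ℕ.<⇒≤ 9<xs)) (few (ℕ.<⇒≤ 9<xs))))))
    where
    few : ∀ {c} → 9 ≤ length xs → length (N a c x xs) ≤ 4
    few 9≤xs = length-N-without-T₅ xs! 9≤xs no5 (here refl)

  -- Edges between the two sides of a vertex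

  module _ {xs c x} (xs! : Unique xs) (18≤xs : 18 ≤ length xs) (no6 : ¬ Has a 6 xs)
           (x∈xs : x ∈ xs) (9≤H : 9 ≤ length (N a c x xs)) where

    private
      -- For `c = false` neighbours and non-neighbours exchange roles, which is the complementary
      -- case.
      H = N a c x xs
      W = N a (not c) x xs

      H! : Unique H
      H! = Unique-N a xs!

      ∈H⁻ : ∀ {h} → h ∈ H → h ∈ xs × h ≢ x × a x h ≡ c
      ∈H⁻ = ∈-N⁻ a xs

      ∈W⁻ : ∀ {w} → w ∈ W → w ∈ xs × w ≢ x × a x w ≡ not c
      ∈W⁻ = ∈-N⁻ a xs

      no5 : ¬ Has a 5 H
      no5 = free-N x∈xs no6

      H≤9 : length H ≤ 9
      H≤9 = length-without-T₅ H! no5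

      8≤W : 8 ≤ length W
      8≤W = ℕ.+-cancelˡ-≤ 9 8 _ (ℕ.≤-trans (s≤s⁻¹ (ℕ.≤-trans 18≤xs (length-N a c x xs!)))
              (ℕ.+-monoˡ-≤ (length W) H≤9))

      H∩W=∅ : ∀ {u} → u ∈ H → u ∉ W
      H∩W=∅ u∈H u∈W = Bool.not-¬ {c} refl
        (trans (sym (proj₂ (proj₂ (∈H⁻ u∈H)))) (proj₂ (proj₂ (∈W⁻ u∈W))))

    -- A T₄ among the vertices of `H` joined to `w` in colour `not c` would grow to T₆ by adding
    -- first `x`, in colour `c`, then `w`, in colour `not c`. So at most four of the nine are of
    -- that kind.
    5≤degree-in-H : ∀ {w} → w ∈ W → 5 ≤ length (ofColour (a w) c H)
    5≤degree-in-H {w} w∈W = ℕ.+-cancelʳ-≤ 4 5 _ (ℕ.≤-trans 9≤H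
      (ℕ.≤-trans (ℕ.≤-reflexive (sym (length-ofColour (a w) c H))) (ℕ.+-monoʳ-≤ _
        (length-without-T₄ H! 9≤H no5 (Unique.filter⁺ _ H!) (proj₁ ∘ ys⁻) no4))))
      where
      ys = ofColour (a w) (not c) H

      ys⁻ : ∀ {u} → u ∈ ys → u ∈ H × a w u ≡ not c
      ys⁻ = ∈-ofColour⁻ (a w) H

      no4 : ¬ Has a 4 ys
      no4 h = no6 (has-add a 5 (proj₁ (∈W⁻ w∈W)) x∷ys⊆
                (has-add a 4 (here refl) ys⊆ h))
        where
        ys⊆ : ys ⊆ N a c x (x ∷ ys)
        ys⊆ u∈ = ∈-N⁺ a x (x ∷ ys) (there u∈)
          (proj₁ (proj₂ (∈H⁻ (proj₁ (ys⁻ u∈))))) (proj₂ (proj₂ (∈H⁻ (proj₁ (ys⁻ u∈)))))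

        x∷ys⊆ : x ∷ ys ⊆ N a (not c) w xs
        x∷ys⊆ (here refl) = ∈-N⁺ a w xs x∈xs (proj₁ (proj₂ (∈W⁻ w∈W)) ∘ sym)
          (trans (Graph.sym G w x) (proj₂ (proj₂ (∈W⁻ w∈W))))
        x∷ys⊆ (there u∈)  = ∈-N⁺ a w xs (proj₁ (∈H⁻ (proj₁ (ys⁻ u∈))))
          (λ { refl → H∩W=∅ (proj₁ (ys⁻ u∈)) w∈W }) (proj₂ (ys⁻ u∈))

    -- All of `zs` is joined to `h` in colour `c`, so `zs` has no T₅ and at most 9 vertices. The
    -- colour is read as `a w h` to match the flipped sum in the double count.
    degree-in-W≤4 : ∀ {h} → h ∈ H → length (ofColour (λ w → a w h) c W) ≤ 4
    degree-in-W≤4 {h} h∈H = ℕ.+-cancelˡ-≤ 5 _ 4 (ℕ.≤-trans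
      -- The 5 stands for `x` and four vertices of `H′`.
      (ℕ.+-monoˡ-≤ (length ws) (s≤s 4≤H′))
      (ℕ.≤-trans (ℕ.≤-reflexive (cong suc (sym (List.length-++ H′))))
        (length-without-T₅ zs! (λ t → no6 (has-add a 5 (proj₁ (∈H⁻ h∈H)) zs⊆ t)))))
      where
      H′ = N a c h H
      ws = ofColour (λ w → a w h) c W
      zs = x ∷ H′ ++ ws

      ws⁻ : ∀ {w} → w ∈ ws → w ∈ W × a w h ≡ c
      ws⁻ = ∈-ofColour⁻ (λ w → a w h) W

      4≤H′ : 4 ≤ length H′
      4≤H′ = ℕ.+-cancelʳ-≤ 4 4 _ (ℕ.≤-trans (s≤s⁻¹ (ℕ.≤-trans 9≤H (length-N a c h H!)))
        (ℕ.+-monoʳ-≤ (length H′) (length-N-without-T₅ H! 9≤H no5 h∈H)))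

      x∉ : ∀ {u} → u ∈ H′ ++ ws → x ≢ u
      x∉ u∈ refl with ∈-++⁻ H′ u∈
      ... | inj₁ u∈H′ = proj₁ (proj₂ (∈H⁻ (proj₁ (∈-N⁻ a H u∈H′)))) refl
      ... | inj₂ u∈ws = proj₁ (proj₂ (∈W⁻ (proj₁ (ws⁻ u∈ws)))) refl

      zs! : Unique zs
      zs! = All.tabulate x∉ ∷ Unique.++⁺ (Unique-N a H!) (Unique.filter⁺ _ (Unique-N a xs!))
        λ (u∈H′ , u∈ws) → H∩W=∅ (proj₁ (∈-N⁻ a H u∈H′)) (proj₁ (ws⁻ u∈ws))

      zs⊆ : zs ⊆ N a c h xs
      zs⊆ (here refl) = ∈-N⁺ a h xs x∈xs (proj₁ (proj₂ (∈H⁻ h∈H)) ∘ sym)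
        (trans (Graph.sym G h x) (proj₂ (proj₂ (∈H⁻ h∈H))))
      zs⊆ (there u∈) with ∈-++⁻ H′ u∈
      ... | inj₁ u∈H′ with ∈-N⁻ a H u∈H′
      ...   | u∈H , u≢h , ahu≡c = ∈-N⁺ a h xs (proj₁ (∈H⁻ u∈H)) u≢h ahu≡c
      zs⊆ (there u∈) | inj₂ u∈ws with ws⁻ u∈ws
      ...   | u∈W , auh≡c = ∈-N⁺ a h xs (proj₁ (∈W⁻ u∈W))
        (λ { refl → H∩W=∅ h∈H u∈W }) (trans (Graph.sym G h _) auh≡c)

    degrees-contradict : ⊥
    degrees-contradict = toWitnessFalse {a? = 40 ℕ.≤? 36} tt (begin
      8 * 5                        ≤⟨ ℕ.*-monoˡ-≤ 5 8≤W ⟩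
      length W * 5                 ≤⟨ sum-map-≥ _ 5 W 5≤degree-in-H ⟩
      sum (degrees a c W H)        ≡⟨ sum-degrees-comm a c W H ⟩
      sum (degrees (flip a) c H W) ≤⟨ sum-map-≤ _ 4 H degree-in-W≤4 ⟩
      length H * 4                 ≤⟨ ℕ.*-monoˡ-≤ 4 H≤9 ⟩
      9 * 4                        ∎)
      where open ℕ.≤-Reasoning

  has-T₆ : ∀ {xs} → Unique xs → 18 ≤ length xs → Has a 6 xs
  -- Since `Has` is decidable, arguing by contradiction is constructive.
  has-T₆ {xs@(x ∷ _)} xs! 18≤xs = decidable-stable (has? a 6 xs) λ no6 →
    [ degrees-contradict {c = true}  xs! 18≤xs no6 (here refl)
    , degrees-contradict {c = false} xs! 18≤xs no6 (here refl) ] one-is-large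
    where
    one-is-large : 9 ≤ length (N a true x xs) ⊎ 9 ≤ length (N a false x xs)
    one-is-large with 9 ℕ.≤? length (N a true x xs) | 9 ℕ.≤? length (N a false x xs)
    ... | yes 9≤ | _      = inj₁ 9≤
    ... | no  _  | yes 9≤ = inj₂ 9≤
    -- Two sides of at most 8 vertices together with `x` make only 17.
    ... | no  ≱9 | no ≱9′ = contradiction
      (ℕ.≤-trans 18≤xs (ℕ.≤-trans (length-N a true x xs!)
        (s≤s (ℕ.+-mono-≤ (s≤s⁻¹ (ℕ.≰⇒> ≱9)) (s≤s⁻¹ (ℕ.≰⇒> ≱9′)))))) (ℕ.n≮n 17)

-- The lower bound

-- The nonzero squares modulo 17.  As −1 is a square, absolute differences suffice.
squares : List ℕ
squares = 1 ∷ 2 ∷ 4 ∷ 8 ∷ 9 ∷ 13 ∷ 15 ∷ 16 ∷ []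

-- The Paley graph itself is `paley 17`. For `m ≤ 17`, `paley m` is induced by its first `m`
-- vertices, so that one computation excludes every such `m`.
paley : ∀ n → Graph n
paley n = record
  { adj    = λ i j → does (∣ toℕ i - toℕ j ∣ ∈? squares)
  ; sym    = λ i j → cong (λ d → does (d ∈? squares)) (ℕ.∣-∣-comm (toℕ i) (toℕ j))
  ; irrefl = λ i → cong (λ d → does (d ∈? squares)) (ℕ.∣n-n∣≡0 (toℕ i))
  }

-- Lets a refutation by `refl` evaluate only the Boolean part of a decision.
does≡false⇒¬ : ∀ {A : Set} (a? : Dec A) → does a? ≡ false → ¬ A
does≡false⇒¬ (no ¬a) _ = ¬a

paley-has-no-T₆ : ¬ Has (adj (paley 17)) 6 (allFin 17)
paley-has-no-T₆ = does≡false⇒¬ (has? (adj (paley 17)) 6 (allFin 17)) refl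

forces⇒18≤ : ∀ m → ForcesThreshold 6 m → 18 ≤ m
forces⇒18≤ m forces = ℕ.≰⇒> λ m≤17 → paley-has-no-T₆ (T₆ m≤17 (forces (paley m)))
  where
  T₆ : m ≤ 17 → ∃[ H ] Threshold {6} H × H ⊑ paley m → Has (adj (paley 17)) 6 (allFin 17)
  T₆ m≤17 (H , thr , H⊑) = has-map {b = adj (paley 17)} (∘-embedding {c = adj (paley 17)}
      (_⊑_.adj-cong H⊑ , λ _ _ → Injection.injective (_⊑_.vertices H⊑)) inject≤-embedding)
    6 {xs = allFin 17} (λ _ → ∈-allFin _) (threshold⇒has thr)
    where
    inject≤-embedding : IsEmbedding (adj (paley m)) (adj (paley 17)) (λ i → inject≤ i m≤17)
    inject≤-embedding =
      (λ i j → cong₂ (λ k l → does (∣ k - l ∣ ∈? squares))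
        (Fin.toℕ-inject≤ i m≤17) (Fin.toℕ-inject≤ j m≤17)) ,
      (λ i j → Fin.inject≤-injective m≤17 m≤17 i j)

theorem3p16 : r′₂[ 6 ]≡ 18
theorem3p16 = (λ G → has⇒threshold G 5 (has-T₆ G (Unique.allFin⁺ 18) ℕ.≤-refl)) , forces⇒18≤
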